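{- Let $M=(s_0,S,R,L)$ be a Kripke structure and $\eta$ a CTL formula. If the algorithm $\textsc{Repair}(M,\eta)$ returns a structure $M'$, then (1) there is a simulation relation from $M'$ to $M$, and (2) for all $\mathrm{ACTL}^*$ formulae $f$, $M\models f$ implies $M'\models f$.
   Context: Let $\mathcal{AP}$ be a set of atomic propositions, including the constants $\mathsf{true}$ and $\mathsf{false}$, which are always interpreted as $\mathit{tt}$ and $\mathit{ff}$ (so $\mathsf{true}\in L(s)$ and $\mathsf{false}\notin L(s)$ for every state $s$). A Kripke structure is a tuple $M=(s_0,S,R,L)$ with $S$ a finite set of states, $s_0\in S$ initial, $R\subseteq S\times S$, $L:S\to2^{\mathcal{AP}}$. It is total if every state has an outgoing transition; the input $M$ is assumed total. Write $s\to t$ for $(s,t)\in R$. A fullpath is an infinite sequence of states consecutive under $R$. $M\models f$ abbreviates $M,s_0\models f$. A simulation relation from $M'=(s_0',S',R',L')$ to $M=(s_0,S,R,L)$ is a relation $H\subseteq S'\times S$ with $(s_0',s_0)\in H$ such that whenever $(s',s)\in H$: $L'(s')=L(s)$, and for every $t'$ with $(s',t')\in R'$ there is $t$ with $(s,t)\in R$ and $(t',t)\in H$. $\mathrm{ACTL}^*$ is the universal fragment of $\mathrm{CTL}^*$: formulae in which negation is applied only to atomic propositions and only the universal path quantifier $\mathsf{A}$ (no existential path quantifier) is used, with the usual $\mathrm{CTL}^*$ semantics over fullpaths. CTL: $\varphi ::= \mathsf{true}\mid\mathsf{false}\mid p\mid\neg\varphi\mid\varphi\land\varphi\mid\varphi\lor\varphi\mid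 \mathsf{AX}\varphi\mid\mathsf{EX}\varphi\mid\mathsf{A}[\varphi\,\mathsf{V}\,\varphi]\mid\mathsf{E}[\varphi\,\mathsf{V}\,\varphi]$, $p\in\mathcal{AP}$. Semantics: $M,s\models p$ iff $p\in L(s)$; constants and boolean connectives as usual; $M,s\models\mathsf{AX}\varphi$ (resp. $\mathsf{EX}\varphi$) iff $M,t\models\varphi$ for all (resp. some) $t$ with $s\to t$; $M,s\models\mathsf{A}[\varphi\,\mathsf{V}\,\psi]$ (resp. $\mathsf{E}[\varphi\,\mathsf{V}\,\psi]$) iff for all (resp. some) fullpaths $s=s_0,s_1,\dots$ from $s$: for all $k\ge0$, if $M,s_j\not\models\varphi$ for all $j<k$ then $M,s_k\models\psi$. $\mathit{sub}(\varphi)$: $\mathit{sub}(p)=\{p\}$ for $p$ an atomic proposition, $\mathsf{true}$ or $\mathsf{false}$; $\mathit{sub}(\neg\varphi)=\{\neg\varphi\}\cup\mathit{sub}(\varphi)$; for $\circ\in\{\land,\lor\}$, $\mathit{sub}(\varphi\circ\psi)=\{\varphi\circ\psi\}\cup\mathit{sub}(\varphi)\cup\mathit{sub}(\psi)$; for $Q\in\{\mathsf{A},\mathsf{E}\}$, $\mathit{sub}(Q\mathsf{X}\varphi)=\{Q\mathsf{X}\varphi\}\cup\mathit{sub}(\varphi)$, and with $\rho=Q[\varphi\,\mathsf{V}\,\psi]$, $\mathit{sub}(\rho)=\{\rho,\ Q\mathsf{X}\rho,\ \varphi\lor Q\mathsf{X}\rho,\ \psi\land(\varphi\lor Q\mathsf{X}\rho)\}\cup\mathit{sub}(\varphi)\cup\mathit{sub}(\psi)$.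 The propositional formula $\mathit{repair}(M,\eta)$ is over propositions $E_{s,t}$ for $(s,t)\in R$; $X_{s,\psi}$ for $s\in S$, $\psi\in\mathit{sub}(\eta)$ (and $X_{s,p}$, $p\in\mathcal{AP}$); and $X^m_{s,\psi}$ for $s\in S$, $0\le m\le n=|S|$, and $\psi\in\mathit{sub}(\eta)$ of the form $\mathsf{A}[\varphi\,\mathsf{V}\,\varphi']$ or $\mathsf{E}[\varphi\,\mathsf{V}\,\varphi']$. It is the conjunction, over all $s\in S$ where $s$ is free, of: - $X_{s_0,\eta}$; - $\bigvee_{t\mid s\to t}E_{s,t}$; - $X_{s,p}$ for all $p\in\mathcal{AP}\cap L(s)$, and $\neg X_{s,p}$ for all $p\in\mathcal{AP}-L(s)$; - $X_{s,\neg\varphi}\equiv\neg X_{s,\varphi}$, $X_{s,\varphi\lor\psi}\equiv X_{s,\varphi}\lor X_{s,\psi}$, $X_{s,\varphi\land\psi}\equiv X_{s,\varphi}\land X_{s,\psi}$ for all $\neg\varphi$, $\varphi\lor\psi$, $\varphi\land\psi\in\mathit{sub}(\eta)$ respectively; - $X_{s,\mathsf{AX}\varphi}\equiv\bigwedge_{t\mid s\to t}(E_{s,t}\Rightarrow X_{t,\varphi})$ for all $\mathsf{AX}\varphi\in\mathit{sub}(\eta)$; $X_{s,\mathsf{EX}\varphi}\equiv\bigvee_{t\mid s\to t}(E_{s,t}\land X_{t,\varphi})$ for all $\mathsf{EX}\varphi\in\mathit{sub}(\eta)$; - for all $\rho=\mathsf{A}[\varphi\,\mathsf{V}\,\psi]\in\mathit{sub}(\eta)$: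 $X_{s,\rho}\equiv X^n_{s,\rho}$; $X^m_{s,\rho}\equiv X_{s,\psi}\land\bigl(X_{s,\varphi}\lor\bigwedge_{t\mid s\to t}(E_{s,t}\Rightarrow X^{m-1}_{t,\rho})\bigr)$ for $m\in\{1,\dots,n\}$; $X^0_{s,\rho}\equiv X_{s,\psi}$; - for all $\rho=\mathsf{E}[\varphi\,\mathsf{V}\,\psi]\in\mathit{sub}(\eta)$: $X_{s,\rho}\equiv X^n_{s,\rho}$; $X^m_{s,\rho}\equiv X_{s,\psi}\land\bigl(X_{s,\varphi}\lor\bigvee_{t\mid s\to t}(E_{s,t}\land X^{m-1}_{t,\rho})\bigr)$ for $m\in\{1,\dots,n\}$; $X^0_{s,\rho}\equiv X_{s,\psi}$. For a satisfying assignment $\mathcal{V}$, $\mathit{model}(M,\mathcal{V})=(s_0',S',R',L')$, where $s_0'=s_0$, $R'=\{(s,t)\mid\mathcal{V}(E_{s,t})=\mathit{tt}\}$, $S'$ is the set of all states reachable from $s_0$ via paths of transitions in $R'$ (and $R'$ is regarded as a relation on $S'$), and $L'=L\upharpoonright S'$. Algorithm $\textsc{Repair}(M,\eta)$: model check $M,s_0\models\eta$; if this holds, return $M$. Otherwise compute $\mathit{repair}(M,\eta)$ and submit it to a sound and complete SAT solver. If the solver returns "not satisfiable", return "failure"; otherwise the solver returns a (some, arbitrary) satisfying assignment $\mathcal{V}$, and the algorithm returns $\mathit{model}(M,\mathcal{V})$. -}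

module Defs where

open import Data.Bool as Bool using (Bool; true; false; T; T?; not; _xor_)
open import Data.Bool.Properties using (T-irrelevant)
open import Data.Fin as Fin using (Fin)
open import Data.Fin.Properties using (+↔⊎; 0↔⊥; 1↔⊤; inj⇒≟)
open import Data.List using (List; []; _∷_; _++_; [_]; map; foldr; mapMaybe; allFin)
open import Data.List.Membership.Propositional using (_∈_)
open import Data.List.Membership.Propositional.Properties using (∈-map⁺; ∈-allFin)
open import Data.List.Relation.Unary.Any using (here; there)
open import Data.Maybe as Maybe using (Maybe; just; nothing; maybe′)
open import Data.Nat using (ℕ; zero; suc; _+_; _≤_; _<_)
open import Data.Product using (Σ; ∃; _×_; _,_; proj₁)
open import Data.Sum using (_⊎_; inj₁; inj₂)
open import Data.Sum.Function.Propositional using (_⊎-↔_)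
open import Function using (_∘_; _↔_; mk↔ₛ′; Inverse)
open import Function.Construct.Composition using (_↔-∘_)
open import Function.Construct.Symmetry using (↔-sym)
open import Function.Properties.Inverse using (↔⇒↣)
open import Level using (0ℓ)
open import Relation.Binary using (Rel; REL; Decidable; DecidableEquality)
open import Relation.Binary.Construct.Closure.ReflexiveTransitive using (Star; ε; _◅_; _◅◅_)
open import Relation.Binary.PropositionalEquality using (_≡_; refl; sym; cong; subst)
open import Relation.Nullary using (¬_; Dec)
open import Relation.Nullary.Decidable using (True; fromWitness; dec⇒maybe; map′; _⊎-dec_; _×-dec_)

Finite : Set → Set
Finite A = ∃ λ n → A ↔ Fin n

module Finiteness where

  T↔Fin : ∀ b → Finite (T b)
  T↔Fin true  = 1 , ↔-sym 1↔⊤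
  T↔Fin false = 0 , ↔-sym 0↔⊥

  Fin-subset : ∀ n (p : Fin n → Bool) → Finite (Σ (Fin n) (T ∘ p))
  Fin-subset zero    p = 0 , mk↔ₛ′ proj₁ (λ ()) (λ ()) (λ ())
  Fin-subset (suc n) p with T↔Fin (p Fin.zero) | Fin-subset n (p ∘ Fin.suc)
  ... | j , f | k , g = j + k , (↔-sym +↔⊎ ↔-∘ ((f ⊎-↔ g) ↔-∘ split))
    where
    split : Σ (Fin (suc n)) (T ∘ p) ↔ (T (p Fin.zero) ⊎ Σ (Fin n) (T ∘ p ∘ Fin.suc))
    split = mk↔ₛ′
      (λ { (Fin.zero , x) → inj₁ x ; (Fin.suc i , x) → inj₂ (i , x) })
      (λ { (inj₁ x) → Fin.zero , x ; (inj₂ (i , x)) → Fin.suc i , x })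
      (λ { (inj₁ x) → refl ; (inj₂ _) → refl })
      (λ { (Fin.zero , x) → refl ; (Fin.suc i , x) → refl })

  Σ-≡ : {A : Set} {p : A → Bool} {x y : Σ A (T ∘ p)} → proj₁ x ≡ proj₁ y → x ≡ y
  Σ-≡ {x = a , _} refl = cong (a ,_) (T-irrelevant _ _)

  subset : {A : Set} → Finite A → (p : A → Bool) → Finite (Σ A (T ∘ p))
  subset {A} (n , A↔n) p with Fin-subset n (p ∘ Inverse.from A↔n)
  ... | k , f = k , (f ↔-∘ transport)
    where
    open Inverse A↔n
    transport : Σ A (T ∘ p) ↔ Σ (Fin n) (T ∘ p ∘ from)
    transport = mk↔ₛ′
      (λ (a , x) → to a , subst (T ∘ p) (sym (strictlyInverseʳ a)) x)
      (λ (i , x) → from i , x)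
      (λ (i , _) → Σ-≡ (strictlyInverseˡ i))
      (λ (a , _) → Σ-≡ (strictlyInverseʳ a))

  ≡-dec : {A : Set} → Finite A → DecidableEquality A
  ≡-dec (_ , A↔n) = inj⇒≟ (↔⇒↣ A↔n)

  elements : {A : Set} → Finite A → List A
  elements (n , A↔n) = map (Inverse.from A↔n) (allFin n)

  ∈-elements : {A : Set} (fin : Finite A) (a : A) → a ∈ elements fin
  ∈-elements (n , A↔n) a =
    subst (_∈ _) (Inverse.strictlyInverseʳ A↔n a)
      (∈-map⁺ (Inverse.from A↔n) (∈-allFin (Inverse.to A↔n a)))

  -- Via vs s t: there is a path from s to t with all intermediate states in vs.
  module Warshall {A : Set} (fin : Finite A) (_⟶_ : Rel A 0ℓ) (_⟶?_ : Decidable _⟶_) where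

    Via : List A → Rel A 0ℓ
    Via []       s t = s ≡ t ⊎ s ⟶ t
    Via (v ∷ vs) s t = Via vs s t ⊎ (Via vs s v × Via vs v t)

    via? : ∀ vs → Decidable (Via vs)
    via? []       s t = ≡-dec fin s t ⊎-dec (s ⟶? t)
    via? (v ∷ vs) s t = via? vs s t ⊎-dec (via? vs s v ×-dec via? vs v t)

    base : ∀ vs {s t} → s ≡ t ⊎ s ⟶ t → Via vs s t
    base []       x = x
    base (v ∷ vs) x = inj₁ (base vs x)

    into : ∀ {v vs s} → Via (v ∷ vs) s v → Via vs s v
    into (inj₁ x)       = x
    into (inj₂ (x , _)) = x

    out : ∀ {v vs t} → Via (v ∷ vs) v t → Via vs v t
    out (inj₁ x)       = x
    out (inj₂ (_ , x)) = x

    join : ∀ {vs s v t} → v ∈ vs → Via vs s v → Via vs v t → Via vs s t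
    join (here refl) x y = inj₂ (into x , out y)
    join (there v∈) (inj₁ x)       (inj₁ y)       = inj₁ (join v∈ x y)
    join (there v∈) (inj₁ x)       (inj₂ (y , z)) = inj₂ (join v∈ x y , z)
    join (there v∈) (inj₂ (x , y)) (inj₁ z)       = inj₂ (x , join v∈ y z)
    join (there v∈) (inj₂ (x , _)) (inj₂ (_ , z)) = inj₂ (x , z)

    sound : ∀ vs {s t} → Via vs s t → Star _⟶_ s t
    sound []       (inj₁ refl)    = ε
    sound []       (inj₂ x)       = x ◅ ε
    sound (v ∷ vs) (inj₁ x)       = sound vs x
    sound (v ∷ vs) (inj₂ (x , y)) = sound vs x ◅◅ sound vs y

    complete : ∀ {s t} → Star _⟶_ s t → Via (elements fin) s t
    complete ε        = base _ (inj₁ refl)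
    complete (x ◅ xs) = join (∈-elements fin _) (base _ (inj₂ x)) (complete xs)

    star? : Decidable (Star _⟶_)
    star? s t = map′ (sound _) complete (via? (elements fin) s t)

-- The constants true and false are themselves members of AP.
module Repairing (AP : Set) (trueᴬ falseᴬ : AP) where

  -- Subsets of S × S and of AP are given by their characteristic functions.
  record Kripke : Set₁ where
    field
      State   : Set
      finite  : Finite State
      s₀      : State
      R       : State → State → Bool
      L       : State → AP → Bool
      true∈L  : ∀ s → L s trueᴬ ≡ true
      false∉L : ∀ s → L s falseᴬ ≡ false

    infix 4 _⟶_
    _⟶_ : Rel State 0ℓ
    s ⟶ t = T (R s t)

    ∣S∣ : ℕ
    ∣S∣ = proj₁ finite

    successors : (s : State) → List (∃ λ t → s ⟶ t)
    successors s =
      mapMaybe (λ t → Maybe.map (t ,_) (dec⇒maybe (T? (R s t)))) (Finiteness.elements finite)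

  open Kripke

  Total : Kripke → Set
  Total M = ∀ s → ∃ λ t → _⟶_ M s t

  record Fullpath (M : Kripke) : Set where
    field
      at   : ℕ → State M
      step : ∀ i → _⟶_ M (at i) (at (suc i))

  open Fullpath

  suffix : ∀ {M} → Fullpath M → ℕ → Fullpath M
  suffix π k = record { at = λ i → at π (i + k) ; step = λ i → step π (i + k) }

  record IsSimulation (M′ M : Kripke) (H : REL (State M′) (State M) 0ℓ) : Set where
    field
      initial : H (s₀ M′) (s₀ M)
      label   : ∀ {s′ s} → H s′ s → ∀ p → L M′ s′ p ≡ L M s p
      forth   : ∀ {s′ s} → H s′ s → ∀ t′ → _⟶_ M′ s′ t′ →
                ∃ λ t → _⟶_ M s t × H t′ t

  infix  9 ~_
  infixr 7 _∧_
  infixr 6 _∨_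

  data CTL : Set where
    atom      : AP → CTL
    ~_        : CTL → CTL
    _∧_ _∨_   : CTL → CTL → CTL
    AX EX     : CTL → CTL
    A[_V_]    : CTL → CTL → CTL
    E[_V_]    : CTL → CTL → CTL

  infix 3 _[_]⊨_ _⊨_

  _[_]⊨_ : (M : Kripke) → State M → CTL → Set
  M [ s ]⊨ atom p     = T (L M s p)
  M [ s ]⊨ ~ φ        = ¬ (M [ s ]⊨ φ)
  M [ s ]⊨ φ ∧ ψ      = (M [ s ]⊨ φ) × (M [ s ]⊨ ψ)
  M [ s ]⊨ φ ∨ ψ      = (M [ s ]⊨ φ) ⊎ (M [ s ]⊨ ψ)
  M [ s ]⊨ AX φ       = ∀ t → _⟶_ M s t → M [ t ]⊨ φ
  M [ s ]⊨ EX φ       = ∃ λ t → _⟶_ M s t × (M [ t ]⊨ φ)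
  M [ s ]⊨ A[ φ V ψ ] =
    (π : Fullpath M) → at π 0 ≡ s →
    ∀ k → (∀ j → j < k → ¬ (M [ at π j ]⊨ φ)) → M [ at π k ]⊨ ψ
  M [ s ]⊨ E[ φ V ψ ] =
    ∃ λ (π : Fullpath M) → at π 0 ≡ s ×
    (∀ k → (∀ j → j < k → ¬ (M [ at π j ]⊨ φ)) → M [ at π k ]⊨ ψ)

  _⊨_ : Kripke → CTL → Set
  M ⊨ φ = M [ s₀ M ]⊨ φ

  sub : CTL → List CTL
  sub (atom p)        = [ atom p ]
  sub (~ φ)           = ~ φ ∷ sub φ
  sub (φ ∧ ψ)         = φ ∧ ψ ∷ sub φ ++ sub ψ
  sub (φ ∨ ψ)         = φ ∨ ψ ∷ sub φ ++ sub ψ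
  sub (AX φ)          = AX φ ∷ sub φ
  sub (EX φ)          = EX φ ∷ sub φ
  sub ρ@(A[ φ V ψ ])  = ρ ∷ AX ρ ∷ φ ∨ AX ρ ∷ ψ ∧ (φ ∨ AX ρ) ∷ sub φ ++ sub ψ
  sub ρ@(E[ φ V ψ ])  = ρ ∷ EX ρ ∷ φ ∨ EX ρ ∷ ψ ∧ (φ ∨ EX ρ) ∷ sub φ ++ sub ψ

  mutual
    data CTL* : Set where
      atom    : AP → CTL*
      ~_      : CTL* → CTL*
      _∧_ _∨_ : CTL* → CTL* → CTL*
      A E     : Path → CTL*

    data Path : Set where
      state       : CTL* → Path
      ~_          : Path → Path
      _∧_ _∨_     : Path → Path → Path
      X           : Path → Path
      [_U_] [_V_] : Path → Path → Path

  infix 3 _[_]⊨ˢ_ _[_]⊨ᵖ_ _⊨*_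

  mutual
    _[_]⊨ˢ_ : (M : Kripke) → State M → CTL* → Set
    M [ s ]⊨ˢ atom p = T (L M s p)
    M [ s ]⊨ˢ ~ f    = ¬ (M [ s ]⊨ˢ f)
    M [ s ]⊨ˢ f ∧ g  = (M [ s ]⊨ˢ f) × (M [ s ]⊨ˢ g)
    M [ s ]⊨ˢ f ∨ g  = (M [ s ]⊨ˢ f) ⊎ (M [ s ]⊨ˢ g)
    M [ s ]⊨ˢ A f    = (π : Fullpath M) → at π 0 ≡ s → M [ π ]⊨ᵖ f
    M [ s ]⊨ˢ E f    = ∃ λ (π : Fullpath M) → at π 0 ≡ s × (M [ π ]⊨ᵖ f)

    _[_]⊨ᵖ_ : (M : Kripke) → Fullpath M → Path → Set
    M [ π ]⊨ᵖ state f   = M [ at π 0 ]⊨ˢ f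
    M [ π ]⊨ᵖ ~ f       = ¬ (M [ π ]⊨ᵖ f)
    M [ π ]⊨ᵖ f ∧ g     = (M [ π ]⊨ᵖ f) × (M [ π ]⊨ᵖ g)
    M [ π ]⊨ᵖ f ∨ g     = (M [ π ]⊨ᵖ f) ⊎ (M [ π ]⊨ᵖ g)
    M [ π ]⊨ᵖ X f       = M [ suffix π 1 ]⊨ᵖ f
    M [ π ]⊨ᵖ [ f U g ] =
      ∃ λ k → (M [ suffix π k ]⊨ᵖ g) × (∀ j → j < k → M [ suffix π j ]⊨ᵖ f)
    M [ π ]⊨ᵖ [ f V g ] =
      ∀ k → (∀ j → j < k → ¬ (M [ suffix π j ]⊨ᵖ f)) → M [ suffix π k ]⊨ᵖ g

  _⊨*_ : Kripke → CTL* → Set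
  M ⊨* f = M [ s₀ M ]⊨ˢ f

  mutual
    data ACTL* : CTL* → Set where
      atom  : ∀ p → ACTL* (atom p)
      ~atom : ∀ p → ACTL* (~ atom p)
      _∧_   : ∀ {f g} → ACTL* f → ACTL* g → ACTL* (f ∧ g)
      _∨_   : ∀ {f g} → ACTL* f → ACTL* g → ACTL* (f ∨ g)
      A     : ∀ {f} → ACTL*-Path f → ACTL* (A f)

    data ACTL*-Path : Path → Set where
      state : ∀ {f} → ACTL* f → ACTL*-Path (state f)
      ~atom : ∀ p → ACTL*-Path (~ state (atom p))
      _∧_   : ∀ {f g} → ACTL*-Path f → ACTL*-Path g → ACTL*-Path (f ∧ g)
      _∨_   : ∀ {f g} → ACTL*-Path f → ACTL*-Path g → ACTL*-Path (f ∨ g)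
      X     : ∀ {f} → ACTL*-Path f → ACTL*-Path (X f)
      [_U_] : ∀ {f g} → ACTL*-Path f → ACTL*-Path g → ACTL*-Path [ f U g ]
      [_V_] : ∀ {f g} → ACTL*-Path f → ACTL*-Path g → ACTL*-Path [ f V g ]

  -- X and Xᵐ are indexed by arbitrary formulae and m; those with no counterpart
  -- in repair M η do not occur in it, so an assignment may treat them freely.
  data Proposition (M : Kripke) : Set where
    E  : ∀ {s t} → _⟶_ M s t → Proposition M
    X  : State M → CTL → Proposition M
    Xᵐ : ℕ → State M → CTL → Proposition M

  infixr 5 _⇒_
  infix  4 _⇔_

  data Formula (P : Set) : Set where
    var             : P → Formula P
    true false      : Formula P
    ~_              : Formula P → Formula P
    _∧_ _∨_ _⇒_ _⇔_ : Formula P → Formula P → Formula P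

  ⋀ ⋁ : {P : Set} → List (Formula P) → Formula P
  ⋀ = foldr _∧_ true
  ⋁ = foldr _∨_ false

  module _ {P : Set} (𝒱 : P → Bool) where

    ⟦_⟧ : Formula P → Bool
    ⟦ var x ⟧ = 𝒱 x
    ⟦ true ⟧  = true
    ⟦ false ⟧ = false
    ⟦ ~ f ⟧   = not ⟦ f ⟧
    ⟦ f ∧ g ⟧ = ⟦ f ⟧ Bool.∧ ⟦ g ⟧
    ⟦ f ∨ g ⟧ = ⟦ f ⟧ Bool.∨ ⟦ g ⟧
    ⟦ f ⇒ g ⟧ = not ⟦ f ⟧ Bool.∨ ⟦ g ⟧
    ⟦ f ⇔ g ⟧ = not (⟦ f ⟧ xor ⟦ g ⟧)

    -- A set of formulae stands for its conjunction.
    Satisfies : (Formula P → Set) → Set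
    Satisfies Φ = ∀ {f} → Φ f → ⟦ f ⟧ ≡ true

  -- The set of conjuncts; as a set, it makes sense also when AP is infinite.
  data repair (M : Kripke) (η : CTL) : Formula (Proposition M) → Set where
    initial : repair M η (var (X (s₀ M) η))
    total   : ∀ s → repair M η (⋁ (map (λ (t , r) → var (E r)) (successors M s)))
    ∈L      : ∀ s p → T (L M s p) → repair M η (var (X s (atom p)))
    ∉L      : ∀ s p → ¬ T (L M s p) → repair M η (~ var (X s (atom p)))
    neg     : ∀ s φ → ~ φ ∈ sub η →
              repair M η (var (X s (~ φ)) ⇔ ~ var (X s φ))
    or      : ∀ s φ ψ → φ ∨ ψ ∈ sub η →
              repair M η (var (X s (φ ∨ ψ)) ⇔ (var (X s φ) ∨ var (X s ψ)))
    and     : ∀ s φ ψ → φ ∧ ψ ∈ sub η →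
              repair M η (var (X s (φ ∧ ψ)) ⇔ (var (X s φ) ∧ var (X s ψ)))
    ax      : ∀ s φ → AX φ ∈ sub η →
              repair M η (var (X s (AX φ)) ⇔
                ⋀ (map (λ (t , r) → var (E r) ⇒ var (X t φ)) (successors M s)))
    ex      : ∀ s φ → EX φ ∈ sub η →
              repair M η (var (X s (EX φ)) ⇔
                ⋁ (map (λ (t , r) → var (E r) ∧ var (X t φ)) (successors M s)))
    av      : ∀ s φ ψ → let ρ = A[ φ V ψ ] in ρ ∈ sub η →
              repair M η (var (X s ρ) ⇔ var (Xᵐ (∣S∣ M) s ρ))
    av-suc  : ∀ s φ ψ m → let ρ = A[ φ V ψ ] in ρ ∈ sub η → suc m ≤ ∣S∣ M →
              repair M η (var (Xᵐ (suc m) s ρ) ⇔ (var (X s ψ) ∧ (var (X s φ) ∨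
                ⋀ (map (λ (t , r) → var (E r) ⇒ var (Xᵐ m t ρ)) (successors M s)))))
    av-zero : ∀ s φ ψ → let ρ = A[ φ V ψ ] in ρ ∈ sub η →
              repair M η (var (Xᵐ 0 s ρ) ⇔ var (X s ψ))
    ev      : ∀ s φ ψ → let ρ = E[ φ V ψ ] in ρ ∈ sub η →
              repair M η (var (X s ρ) ⇔ var (Xᵐ (∣S∣ M) s ρ))
    ev-suc  : ∀ s φ ψ m → let ρ = E[ φ V ψ ] in ρ ∈ sub η → suc m ≤ ∣S∣ M →
              repair M η (var (Xᵐ (suc m) s ρ) ⇔ (var (X s ψ) ∧ (var (X s φ) ∨
                ⋁ (map (λ (t , r) → var (E r) ∧ var (Xᵐ m t ρ)) (successors M s)))))
    ev-zero : ∀ s φ ψ → let ρ = E[ φ V ψ ] in ρ ∈ sub η →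
              repair M η (var (Xᵐ 0 s ρ) ⇔ var (X s ψ))

  module _ (M : Kripke) (𝒱 : Proposition M → Bool) where

    retained : State M → State M → Bool
    retained s t = maybe′ (λ r → 𝒱 (E r)) false (dec⇒maybe (T? (R M s t)))

    reachable? : ∀ s → Dec (Star (λ s t → T (retained s t)) (s₀ M) s)
    reachable? = Finiteness.Warshall.star? (finite M) _ (λ s t → T? (retained s t)) (s₀ M)

    -- True (reachable? s) is a proof-irrelevant form of reachability, so that the
    -- states of the model form a subset of those of M.
    model : Kripke
    model = record
      { State   = Σ (State M) (λ s → True (reachable? s))
      ; finite  = Finiteness.subset (finite M) _
      ; s₀      = s₀ M , fromWitness ε
      ; R       = λ (s , _) (t , _) → retained s t
      ; L       = λ (s , _) → L M s
      ; true∈L  = λ (s , _) → true∈L M s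
      ; false∉L = λ (s , _) → false∉L M s
      }

  -- Repair M η r: r is a possible result of the algorithm, `nothing` being "failure".
  -- The algorithm is a relation because the SAT solver's choice of 𝒱 is arbitrary.
  data Repair (M : Kripke) (η : CTL) : Maybe Kripke → Set₁ where
    unchanged : M ⊨ η → Repair M η (just M)
    repaired  : ¬ (M ⊨ η) → (𝒱 : Proposition M → Bool) → Satisfies 𝒱 (repair M η) →
                Repair M η (just (model M 𝒱))
    failure   : ¬ (M ⊨ η) → (∀ 𝒱 → ¬ Satisfies 𝒱 (repair M η)) → Repair M η nothing

{-# OPTIONS --safe #-}
-- Deleting transitions leaves the identity relation a simulation. A fullpath of
-- the simulating structure can be built step by step along any fullpath of the
-- simulated one, so ACTL* formulae are inherited, by induction on the formula.
module Submission where

open import Data.Bool using (T; T?)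
open import Data.Maybe using (just)
open import Data.Nat using (zero; suc; _+_)
open import Data.Product using (∃; _×_; _,_; proj₁; proj₂)
open import Data.Sum as Sum using ()
open import Function using (_∘_)
open import Level using (0ℓ)
open import Relation.Binary using (REL)
open import Relation.Binary.PropositionalEquality using (_≡_; refl; sym; subst)
open import Relation.Nullary using (yes; no)
open import Defs

module _ {AP : Set} {trueᴬ falseᴬ : AP} where

  open Repairing AP trueᴬ falseᴬ
  open Kripke
  open Fullpath

  module Preservation {M′ M : Kripke} {H : REL (State M′) (State M) 0ℓ}
                      (sim : IsSimulation M′ M H) where

    open IsSimulation sim

    _≲_ : Fullpath M′ → Fullpath M → Set
    π′ ≲ π = ∀ i → H (at π′ i) (at π i)

    suffix-≲ : ∀ {π′ π} → π′ ≲ π → ∀ k → suffix π′ k ≲ suffix π k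
    suffix-≲ π′≲π k i = π′≲π (i + k)

    module _ (π′ : Fullpath M′) {s} (h : H (at π′ 0) s) where

      -- Each state is kept with its proof of `H`, because `forth` needs that proof to choose the
      -- next state.
      matching : ∀ i → ∃ λ t → H (at π′ i) t
      matching zero    = s , h
      matching (suc i) with forth (proj₂ (matching i)) (at π′ (suc i)) (step π′ i)
      ... | t , _ , h′ = t , h′

      match : Fullpath M
      match = record
        { at   = proj₁ ∘ matching
        -- The same call of `forth` as in `matching`, so its target is by definition the next state
        -- of the path.
        ; step = λ i → proj₁ (proj₂ (forth (proj₂ (matching i)) (at π′ (suc i)) (step π′ i)))
        }

      ≲-match : π′ ≲ match
      ≲-match = proj₂ ∘ matching

    mutual
      preserve : ∀ {f s′ s} → ACTL* f → H s′ s → M [ s ]⊨ˢ f → M′ [ s′ ]⊨ˢ f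
      preserve (atom p)  h x         = subst T (sym (label h p)) x
      -- Labels of related states are equal, not merely included, so negated atoms transfer as well.
      preserve (~atom p) h x         = x ∘ subst T (label h p)
      preserve (f ∧ g)   h (x , y)   = preserve f h x , preserve g h y
      preserve (f ∨ g)   h x         = Sum.map (preserve f h) (preserve g h) x
      -- `π′` starts at `s′`, and its match starts at `s` by definition, so `x` applies to the
      -- match.
      preserve (A f)     h x π′ refl =
        preserveᵖ f (≲-match π′ h) (x (match π′ h) refl)

      preserveᵖ : ∀ {f π′ π} → ACTL*-Path f → π′ ≲ π → M [ π ]⊨ᵖ f → M′ [ π′ ]⊨ᵖ f
      preserveᵖ (state f) π′≲π x           = preserve f (π′≲π 0) x
      preserveᵖ (~atom p) π′≲π x           = x ∘ subst T (label (π′≲π 0) p)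
      preserveᵖ (f ∧ g)   π′≲π (x , y)     = preserveᵖ f π′≲π x , preserveᵖ g π′≲π y
      preserveᵖ (f ∨ g)   π′≲π x           = Sum.map (preserveᵖ f π′≲π) (preserveᵖ g π′≲π) x
      preserveᵖ {π′ = π′} {π} (X f) π′≲π x =
        preserveᵖ f (suffix-≲ {π′} {π} π′≲π 1) x
      preserveᵖ {π′ = π′} {π} [ f U g ] π′≲π (k , y , x) =
        k , preserveᵖ g (suffix-≲ {π′} {π} π′≲π k) y ,
        λ j j<k → preserveᵖ f (suffix-≲ {π′} {π} π′≲π j) (x j j<k)
      preserveᵖ {π′ = π′} {π} [ f V g ] π′≲π x k ¬f =
        -- `x` needs `f` to fail along `π` before `k`. It is known to fail along `π′`, and
        -- preservation of `f`, contraposed, carries this over.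
        preserveᵖ g (suffix-≲ {π′} {π} π′≲π k)
          (x k λ j j<k → ¬f j j<k ∘ preserveᵖ f (suffix-≲ {π′} {π} π′≲π j))

  ≡-isSimulation : ∀ {M} → IsSimulation M M _≡_
  ≡-isSimulation = record
    { initial = refl
    ; label   = λ { refl p → refl }
    ; forth   = λ { refl t s⟶t → t , s⟶t , refl }
    }

  retained⇒⟶ : ∀ M 𝒱 s t → T (retained M 𝒱 s t) → _⟶_ M s t
  retained⇒⟶ M 𝒱 s t x with T? (R M s t)
  ... | yes s⟶t = s⟶t
  -- Off `R`, `retained` takes its default value `false`.
  ... | no  _   with () ← x

  -- States of `model M 𝒱` carry a reachability proof, so the identity takes the form of the graph
  -- of `proj₁`.
  model-isSimulation : ∀ M 𝒱 → IsSimulation (model M 𝒱) M (λ s′ s → proj₁ s′ ≡ s)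
  model-isSimulation M 𝒱 = record
    { initial = refl
    ; label   = λ { refl p → refl }
    ; forth   = λ { {s , _} refl (t , _) x → t , retained⇒⟶ M 𝒱 s t x , refl }
    }

  Repair-isSimulation : ∀ {M η M′} → Repair M η (just M′) → ∃ λ H → IsSimulation M′ M H
  Repair-isSimulation     (unchanged _)    = _ , ≡-isSimulation
  Repair-isSimulation {M} (repaired _ 𝒱 _) = _ , model-isSimulation M 𝒱

proposition1 : (AP : Set) (trueᴬ falseᴬ : AP) →
    let open Repairing AP trueᴬ falseᴬ in
    (M : Kripke) → Total M →
    (η : CTL) (M′ : Kripke) → Repair M η (just M′) →
    (∃ λ H → IsSimulation M′ M H) ×
    (∀ f → ACTL* f → M ⊨* f → M′ ⊨* f)
proposition1 AP trueᴬ falseᴬ M _ η M′ r with Repair-isSimulation r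
... | H , sim = (H , sim) , λ f f∈ACTL* → preserve f∈ACTL* initial
  where
  open Preservation sim
  open Repairing.IsSimulation sim
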